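{- Let $\sigma\in\{\textsf{Sup},\textsf{KK},\textsf{PSt},\textsf{St},\textsf{WF}\}$ and let $\mathcal T$ be a permaconsistent distributed theory. Then $\mathcal T$ is universally consistent under $\sigma$, i.e. every $\sigma$-model of $\mathcal T$ is universally consistent.
   Context: Standing setup (dAEL). $\Sigma=\Sigma_o\uplus\Sigma_s$ is a first-order vocabulary (objective and subjective symbols). A nonempty domain $D$ and a $\Sigma_o$-structure $I_o$ with domain $D$ are fixed, as is a set of agents $\mathcal{A}\subseteq D$. For each $A\in\mathcal{A}$ there is a constant $A\in\Sigma_o$ with $A^{I_o}=A$, and $\Sigma_o$ contains a unary predicate $\mathrm{Apred}$ with $\mathrm{Apred}^{I_o}=\mathcal{A}$. "Structure" means a $\Sigma$-structure with domain $D$ that agrees with $I_o$ on $\Sigma_o$. Formulas of dAEL are built from atoms $P(\bar t)$ ($P\in\Sigma$ or equality) using $\wedge,\neg,\forall x$, and the modal rule: if $\varphi$ is a formula and $t$ a term then $K_t\varphi$ is a formula ($\vee,\Rightarrow,\Leftrightarrow,\exists$ are the usual abbreviations). Truth values are $\mathbf t,\mathbf f,\mathbf u$ with truth order $\mathbf f<_t\mathbf u<_t\mathbf t$; $\mathbf t^{ -1}=\mathbf f$, $\mathbf f^{ -1}=\mathbf t$, $\mathbf u^{ -1}=\mathbf u$. A possible world structure (PWS) is a set of structures; $Q_1\le_K Q_2$ iff $Q_2\subseteq Q_1$; $\bot$ denotes the set of all structures and $\top=\emptyset$. A distributed possible world structure (DPWS) is a family $\mathcal Q=(\mathcal Q_A)_{A\in\mathcal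 A}$ of PWSs, ordered pointwise by $\le_K$. A distributed belief pair (DBP) is a pair $\mathcal B=(\mathcal B^c,\mathcal B^l)$ of DPWSs; $(\mathcal P,\mathcal S)\le_p(\mathcal P',\mathcal S')$ iff $\mathcal P\le_K\mathcal P'$ and $\mathcal S'\le_K\mathcal S$. A DBP is consistent if $\mathcal B^c\le_K\mathcal B^l$ (i.e. $\mathcal B^l_A\subseteq\mathcal B^c_A$ for all $A$); DBPs are tacitly assumed consistent unless said otherwise, and a DPWS $\mathcal Q$ is identified with the exact DBP $(\mathcal Q,\mathcal Q)$. Two-valued value $\varphi^{\mathcal Q,I,a}$ (DPWS $\mathcal Q$, structure $I$, variable assignment $a$): standard first-order clauses for atoms, $\neg,\wedge,\forall$, and $(K_t\varphi)^{\mathcal Q,I,a}=\mathbf t$ iff $t^{I,a}\in\mathcal A$ and $\varphi^{\mathcal Q,J,a}=\mathbf t$ for every $J\in\mathcal Q_{t^{I,a}}$, otherwise $\mathbf f$. Three-valued value $\varphi^{\mathcal B,I,a}$ for any pair $\mathcal B$ of DPWSs: atoms get their two-valued value in $I$; $\neg$ is interpreted by ${}^{ -1}$, and $\wedge$, $\forall$ by $\le_t$-greatest lower bound (Kleene); $(K_t\varphi)^{\mathcal B,I,a}$ is $\mathbf t$ if $t^{I,a}\in\mathcal A$ and $\varphi^{\mathcal B,J,a}=\mathbf t$ for all $J\in\mathcal B^c_{t^{I,a}}$; it is $\mathbf f$ if $t^{I,a}\notin\mathcal A$ or $\varphi^{\mathcal B,J,a}=\mathbf f$ for some $J\in\mathcal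 B^l_{t^{I,a}}$; and $\mathbf u$ otherwise. For sentences the assignment is omitted, and the value of a set of sentences is the $\le_t$-glb of the values of its members. A distributed theory is a family $\mathcal T=(\mathcal T_A)_{A\in\mathcal A}$ of sets of dAEL sentences. Operators: $D_{\mathcal T}(\mathcal Q)=(\{I:\mathcal T_A^{\mathcal Q,I}=\mathbf t\})_{A\in\mathcal A}$; $D^*_{\mathcal T}(\mathcal B)=(D^c_{\mathcal T}(\mathcal B),D^l_{\mathcal T}(\mathcal B))$ with $D^c_{\mathcal T}(\mathcal B)_A=\{I:\mathcal T_A^{\mathcal B,I}\ne\mathbf f\}$ and $D^l_{\mathcal T}(\mathcal B)_A=\{I:\mathcal T_A^{\mathcal B,I}=\mathbf t\}$; the stable operator $S_{\mathcal T}(\mathcal Q)$ is the $\le_K$-least fixpoint of $\mathcal Q'\mapsto D^c_{\mathcal T}((\mathcal Q',\mathcal Q))$. Models of $\mathcal T$ (w.r.t. $I_o$): a Sup-model is a DPWS fixpoint of $D_{\mathcal T}$; the KK-model is the $\le_p$-least fixpoint of $D^*_{\mathcal T}$; a PSt-model is a DBP $\mathcal B$ with $\mathcal B^c=S_{\mathcal T}(\mathcal B^l)$ and $\mathcal B^l=S_{\mathcal T}(\mathcal B^c)$; an St-model is a DPWS $\mathcal Q$ such that $(\mathcal Q,\mathcal Q)$ is a PSt-model; the WF-model is the $\le_p$-least PSt-model. Universal consistency: a DPWS $\mathcal Q$ is universally consistent if $\mathcal Q_A\neq\emptyset$ for all $A\in\mathcal A$; a DBP $\mathcal B$ is universally consistent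 if $\mathcal B^l$ is. Permaconsistency: $\mathcal T$ is permaconsistent if for each $A\in\mathcal A$ and each theory $T'$ obtained from $\mathcal T_A$ by replacing each occurrence of a subformula $K_t\varphi$ that is not nested under a modal operator by $\mathbf t$ or by $\mathbf f$ (independently per occurrence), $T'$ has a model that is a structure (i.e. expands $I_o$). -}

module Defs where

open import Level using (Level; 0ℓ; Lift; _⊔_) renaming (suc to lsuc)
open import Data.Bool.Base using (Bool; true; false; T; if_then_else_)
open import Data.Empty using (⊥)
open import Data.Fin.Base using (Fin)
open import Data.Nat.Base using (ℕ; suc)
open import Data.Product.Base using (Σ; Σ-syntax; ∃; ∃-syntax; _×_; _,_; proj₁; proj₂)
open import Data.Sum.Base using (_⊎_; inj₁; inj₂)
open import Data.Unit.Base using (⊤)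
open import Data.Vec.Base using (Vec; []; _∷_; lookup)
open import Relation.Binary.PropositionalEquality using (_≡_)
open import Relation.Nullary.Negation.Core using (¬_)
open import Relation.Unary using (Pred; Satisfiable; _∈_; _⊆_; _≐_)

record Vocabulary : Set₁ where
  field
    Fun : ℕ → Set
    Rel : ℕ → Set

open Vocabulary public

_⊎ᵥ_ : Vocabulary → Vocabulary → Vocabulary
(V ⊎ᵥ W) .Fun k = Fun V k ⊎ Fun W k
(V ⊎ᵥ W) .Rel k = Rel V k ⊎ Rel W k

record Interpretation (V : Vocabulary) (D : Set) : Set where
  field
    fun : ∀ {k} → Fun V k → Vec D k → D
    rel : ∀ {k} → Rel V k → Vec D k → Bool

open Interpretation public

_⊎ᵢ_ : ∀ {V W D} → Interpretation V D → Interpretation W D →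
       Interpretation (V ⊎ᵥ W) D
(I ⊎ᵢ J) .fun (inj₁ f) = fun I f
(I ⊎ᵢ J) .fun (inj₂ f) = fun J f
(I ⊎ᵢ J) .rel (inj₁ P) = rel I P
(I ⊎ᵢ J) .rel (inj₂ P) = rel J P

-- `Term V n` and the formulas below have their free variables among n
-- de Bruijn variables; an assignment is a vector of n domain elements.
data Term (V : Vocabulary) (n : ℕ) : Set where
  var : Fin n → Term V n
  app : ∀ {k} → Fun V k → Vec (Term V n) k → Term V n

module _ {V : Vocabulary} {D : Set} (I : Interpretation V D) where

  mutual
    eval : ∀ {n} → Vec D n → Term V n → D
    eval a (var x)    = lookup a x
    eval a (app f ts) = fun I f (evals a ts)

    evals : ∀ {n k} → Vec D n → Vec (Term V n) k → Vec D k
    evals a []       = []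
    evals a (t ∷ ts) = eval a t ∷ evals a ts

record Setting : Set₁ where
  field
    Σo Σs      : Vocabulary
    D          : Set
    d₀         : D
    Io         : Interpretation Σo D
    isAgent    : D → Bool

  -- T (isAgent d) is proof-irrelevant, so this is a genuine subset of D.
  Agent : Set
  Agent = Σ[ d ∈ D ] T (isAgent d)

  field
    agentConst   : Agent → Fun Σo 0
    agentConst-I : ∀ A → fun Io (agentConst A) [] ≡ proj₁ A
    Apred        : Rel Σo 1
    Apred-I      : ∀ d → rel Io Apred (d ∷ []) ≡ isAgent d

data 𝟛 : Set where
  𝐭 𝐟 𝐮 : 𝟛

_⁻¹ : 𝟛 → 𝟛
𝐭 ⁻¹ = 𝐟
𝐟 ⁻¹ = 𝐭
𝐮 ⁻¹ = 𝐮

-- A truth value given by cases is represented by the predicate "v is its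
-- value", so that nothing has to be decided in order to define it:
-- "𝐭 if P, 𝐟 if N, and 𝐮 otherwise".
cases : Set → Set → Pred 𝟛 0ℓ
cases P N 𝐭 = P
cases P N 𝐟 = N
cases P N 𝐮 = ¬ P × ¬ N

-- Greatest lower bound of a family in the truth order 𝐟 < 𝐮 < 𝐭.
glb : {X : Set} → (X → Pred 𝟛 0ℓ) → Pred 𝟛 0ℓ
glb V = cases (∀ x → V x 𝐭) (∃[ x ] V x 𝐟)

data Semantics : Set where
  Sup KK PSt St WF : Semantics

IsLeast : {p : Level} {X : Set₁} → (X → X → Set) → Pred X p → X → Set (lsuc 0ℓ ⊔ p)
IsLeast _≤_ P x = P x × (∀ y → P y → x ≤ y)

module dAEL (S : Setting) where
  open Setting S

  Voc : Vocabulary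
  Voc = Σo ⊎ᵥ Σs

  -- A Voc-interpretation on D that agrees with Io on Σo is determined by
  -- its Σs-part.
  Structure : Set
  Structure = Interpretation Σs D

  full : Structure → Interpretation Voc D
  full I = Io ⊎ᵢ I

  ⟦_⟧ : ∀ {n} → Term Voc n → Structure → Vec D n → D
  ⟦ t ⟧ I a = eval (full I) a t

  infixr 6 _∧′_
  infix  7 ¬′_

  data Formula (n : ℕ) : Set where
    atom : ∀ {k} → Rel Voc k → Vec (Term Voc n) k → Formula n
    _≈′_ : Term Voc n → Term Voc n → Formula n
    ¬′_  : Formula n → Formula n
    _∧′_ : Formula n → Formula n → Formula n
    ∀′   : Formula (suc n) → Formula n
    K    : Term Voc n → Formula n → Formula n

  Sentence : Set
  Sentence = Formula 0

  Theory : Set₁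
  Theory = Pred Sentence 0ℓ

  DistributedTheory : Set₁
  DistributedTheory = Agent → Theory

  PWS : Set₁
  PWS = Pred Structure 0ℓ

  infix 4 _≤K_ _≈K_ _≤p_ _≈p_

  DPWS : Set₁
  DPWS = Agent → PWS

  _≤K_ : DPWS → DPWS → Set
  Q ≤K Q′ = ∀ A → Q′ A ⊆ Q A

  _≈K_ : DPWS → DPWS → Set
  Q ≈K Q′ = ∀ A → Q A ≐ Q′ A

  Pair : Set₁
  Pair = DPWS × DPWS

  _≤p_ : Pair → Pair → Set
  (P , R) ≤p (P′ , R′) = P ≤K P′ × R′ ≤K R

  _≈p_ : Pair → Pair → Set
  (P , R) ≈p (P′ , R′) = P ≈K P′ × R ≈K R′

  Consistent : Pair → Set
  Consistent (P , R) = P ≤K R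

  record DBP : Set₁ where
    constructor dbp
    field
      pair       : Pair
      consistent : Consistent pair

    c l : DPWS
    c = proj₁ pair
    l = proj₂ pair

  exact : DPWS → DBP
  exact Q = dbp (Q , Q) (λ A I∈Q → I∈Q)

  AtomHolds : ∀ {n k} → Rel Voc k → Vec (Term Voc n) k → Structure → Vec D n → Set
  AtomHolds P ts I a = T (rel (full I) P (evals (full I) a ts))

  -- `Sat φ Q I a` says that φ has two-valued value 𝐭; otherwise the value is 𝐟.
  Sat : ∀ {n} → Formula n → DPWS → Structure → Vec D n → Set
  Sat (atom P ts) Q I a = AtomHolds P ts I a
  Sat (s ≈′ t)    Q I a = ⟦ s ⟧ I a ≡ ⟦ t ⟧ I a
  Sat (¬′ φ)      Q I a = ¬ Sat φ Q I a
  Sat (φ ∧′ ψ)    Q I a = Sat φ Q I a × Sat ψ Q I a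
  Sat (∀′ φ)      Q I a = ∀ d → Sat φ Q I (d ∷ a)
  Sat (K t φ)     Q I a =
    Σ[ A∈𝒜 ∈ T (isAgent (⟦ t ⟧ I a)) ]
      (∀ J → J ∈ Q (⟦ t ⟧ I a , A∈𝒜) → Sat φ Q J a)

  SatTheory : Theory → DPWS → Structure → Set
  SatTheory Th Q I = ∀ φ → φ ∈ Th → Sat φ Q I []

  -- `Value φ B I a v` says that φ has three-valued value v.
  --
  -- On consistent pairs the 𝐭- and 𝐟-clauses exclude each other.  The
  -- stable operator also evaluates formulas in inconsistent pairs, where
  -- the two clauses for K can both apply.  Then neither overrides the
  -- other, and a formula may have both values, as in Belnap's four-valued
  -- logic.  This is the reading under which Dᶜ (Q′ , Q) is ≤K-monotone in
  -- Q′, so that the stable operator is well defined.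
  Value : ∀ {n} → Formula n → Pair → Structure → Vec D n → Pred 𝟛 0ℓ
  Value (atom P ts) B I a = cases (AtomHolds P ts I a) (¬ AtomHolds P ts I a)
  Value (s ≈′ t)    B I a =
    cases (⟦ s ⟧ I a ≡ ⟦ t ⟧ I a) (¬ (⟦ s ⟧ I a ≡ ⟦ t ⟧ I a))
  Value (¬′ φ)      B I a = λ v → Value φ B I a (v ⁻¹)
  Value (φ ∧′ ψ)    B I a = glb (λ b → if b then Value φ B I a else Value ψ B I a)
  Value (∀′ φ)      B I a = glb (λ d → Value φ B I (d ∷ a))
  Value (K t φ)     B I a = cases
    (Σ[ A∈𝒜 ∈ T (isAgent (⟦ t ⟧ I a)) ]
      (∀ J → J ∈ proj₁ B (⟦ t ⟧ I a , A∈𝒜) → Value φ B J a 𝐭))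
    ((¬ T (isAgent (⟦ t ⟧ I a))) ⊎
     (Σ[ A∈𝒜 ∈ T (isAgent (⟦ t ⟧ I a)) ]
       ∃[ J ] (J ∈ proj₂ B (⟦ t ⟧ I a , A∈𝒜) × Value φ B J a 𝐟)))

  ValueTheory : Theory → Pair → Structure → Pred 𝟛 0ℓ
  ValueTheory Th B I = glb {∃ Th} (λ φ → Value (proj₁ φ) B I [])

  module _ (𝒯 : DistributedTheory) where

    Dop : DPWS → DPWS
    Dop Q A I = SatTheory (𝒯 A) Q I

    Dᶜ Dˡ : Pair → DPWS
    Dᶜ B A I = ¬ ValueTheory (𝒯 A) B I 𝐟
    Dˡ B A I = ValueTheory (𝒯 A) B I 𝐭

    D* : Pair → Pair
    D* B = Dᶜ B , Dˡ B

    -- `Stable Q P` says that P is the value of the stable operator at Q.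
    Stable : DPWS → DPWS → Set₁
    Stable Q = IsLeast _≤K_ (λ Q′ → Dᶜ (Q′ , Q) ≈K Q′)

    IsSup : DPWS → Set
    IsSup Q = Dop Q ≈K Q

    IsKK : DBP → Set₁
    IsKK = IsLeast (λ B B′ → DBP.pair B ≤p DBP.pair B′)
                   (λ B → D* (DBP.pair B) ≈p DBP.pair B)

    IsPSt : DBP → Set₁
    IsPSt B = Stable (DBP.l B) (DBP.c B) × Stable (DBP.c B) (DBP.l B)

    IsSt : DPWS → Set₁
    IsSt Q = IsPSt (exact Q)

    IsWF : DBP → Set₁
    IsWF = IsLeast (λ B B′ → DBP.pair B ≤p DBP.pair B′) IsPSt

  Candidate : Semantics → Set₁
  Candidate Sup = DPWS
  Candidate KK  = DBP
  Candidate PSt = DBP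
  Candidate St  = DPWS
  Candidate WF  = DBP

  IsModel : (σ : Semantics) → DistributedTheory → Candidate σ → Set₁
  IsModel Sup 𝒯 Q = Lift _ (IsSup 𝒯 Q)
  IsModel KK  𝒯 B = IsKK 𝒯 B
  IsModel PSt 𝒯 B = IsPSt 𝒯 B
  IsModel St  𝒯 Q = IsSt 𝒯 Q
  IsModel WF  𝒯 B = IsWF 𝒯 B

  UniversallyConsistentDPWS : DPWS → Set
  UniversallyConsistentDPWS Q = ∀ A → Satisfiable (Q A)

  UniversallyConsistentDBP : DBP → Set
  UniversallyConsistentDBP B = UniversallyConsistentDPWS (DBP.l B)

  UniversallyConsistent : (σ : Semantics) → Candidate σ → Set
  UniversallyConsistent Sup = UniversallyConsistentDPWS
  UniversallyConsistent KK  = UniversallyConsistentDBP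
  UniversallyConsistent PSt = UniversallyConsistentDBP
  UniversallyConsistent St  = UniversallyConsistentDPWS
  UniversallyConsistent WF  = UniversallyConsistentDBP

  UniversallyConsistentUnder : Semantics → DistributedTheory → Set₁
  UniversallyConsistentUnder σ 𝒯 =
    (M : Candidate σ) → IsModel σ 𝒯 M → UniversallyConsistent σ M

  -- First-order formulas with constants for 𝐭 and 𝐟: the results of
  -- replacing the modal subformulas.
  data FOFormula (n : ℕ) : Set where
    atom  : ∀ {k} → Rel Voc k → Vec (Term Voc n) k → FOFormula n
    _≈′_  : Term Voc n → Term Voc n → FOFormula n
    ¬′_   : FOFormula n → FOFormula n
    _∧′_  : FOFormula n → FOFormula n → FOFormula n
    ∀′    : FOFormula (suc n) → FOFormula n
    const : Bool → FOFormula n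

  FOSat : ∀ {n} → FOFormula n → Structure → Vec D n → Set
  FOSat (atom P ts) I a = AtomHolds P ts I a
  FOSat (s ≈′ t)    I a = ⟦ s ⟧ I a ≡ ⟦ t ⟧ I a
  FOSat (¬′ φ)      I a = ¬ FOSat φ I a
  FOSat (φ ∧′ ψ)    I a = FOSat φ I a × FOSat ψ I a
  FOSat (∀′ φ)      I a = ∀ d → FOSat φ I (d ∷ a)
  FOSat (const b)   I a = T b

  -- The occurrences of modal subformulas not nested under a modal operator.
  ModalOcc : ∀ {n} → Formula n → Set
  ModalOcc (atom P ts) = ⊥
  ModalOcc (s ≈′ t)    = ⊥
  ModalOcc (¬′ φ)      = ModalOcc φ
  ModalOcc (φ ∧′ ψ)    = ModalOcc φ ⊎ ModalOcc ψ
  ModalOcc (∀′ φ)      = ModalOcc φ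
  ModalOcc (K t φ)     = ⊤

  replace : ∀ {n} (φ : Formula n) → (ModalOcc φ → Bool) → FOFormula n
  replace (atom P ts) ρ = atom P ts
  replace (s ≈′ t)    ρ = s ≈′ t
  replace (¬′ φ)      ρ = ¬′ replace φ ρ
  replace (φ ∧′ ψ)    ρ = replace φ (λ o → ρ (inj₁ o)) ∧′ replace ψ (λ o → ρ (inj₂ o))
  replace (∀′ φ)      ρ = ∀′ (replace φ ρ)
  replace (K t φ)     ρ = const (ρ _)

  replaceTheory : Theory → ((φ : Sentence) → ModalOcc φ → Bool) → Pred (FOFormula 0) 0ℓ
  replaceTheory Th ρ ψ = ∃[ φ ] (φ ∈ Th × ψ ≡ replace φ (ρ φ))

  Permaconsistent : DistributedTheory → Set
  Permaconsistent 𝒯 = ∀ A (ρ : (φ : Sentence) → ModalOcc φ → Bool) →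
    ∃[ I ] (∀ ψ → ψ ∈ replaceTheory (𝒯 A) ρ → FOSat ψ I [])

{-# OPTIONS --safe #-}
-- Replace every positive top-level modal occurrence by 𝐟 and every negative
-- one by 𝐭.  By Kleene monotonicity the resulting first-order sentence is a
-- lower bound of the original one in the truth order, whatever the modal
-- subformulas evaluate to.  Hence the structure that permaconsistency supplies
-- for 𝒯 A lies in (D 𝒯 Q) A, (Dˡ 𝒯 B) A and (Dᶜ 𝒯 B) A for all Q and B, and so
-- in the A-component of every fixpoint.
module Submission where

open import Defs
open import Level using (0ℓ; lower)
open import Axiom.ExcludedMiddle using (ExcludedMiddle)
open import Axiom.DoubleNegationElimination using (DoubleNegationElimination; em⇒dne)
open import Data.Bool.Base using (Bool; true; false)
open import Data.Product.Base using (∃-syntax; _,_; proj₁)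
open import Data.Sum.Base using (inj₁; inj₂)
open import Data.Vec.Base using (Vec; []; _∷_)
open import Relation.Binary.PropositionalEquality using (refl)
open import Relation.Nullary.Negation.Core using (¬_)

module _ (S : Setting) where
  open Setting S
  open dAEL S

  mutual
    -- Polarity is carried by the mutual recursion: only `¬′` passes from one function to the other.
    -- Clauses for atoms are absent because `ModalOcc` is empty there.
    pessimistic : ∀ {n} (φ : Formula n) → ModalOcc φ → Bool
    pessimistic (¬′ φ)   o        = optimistic φ o
    pessimistic (φ ∧′ ψ) (inj₁ o) = pessimistic φ o
    pessimistic (φ ∧′ ψ) (inj₂ o) = pessimistic ψ o
    pessimistic (∀′ φ)   o        = pessimistic φ o
    pessimistic (K t φ)  _        = false

    optimistic : ∀ {n} (φ : Formula n) → ModalOcc φ → Bool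
    optimistic (¬′ φ)   o        = pessimistic φ o
    optimistic (φ ∧′ ψ) (inj₁ o) = optimistic φ o
    optimistic (φ ∧′ ψ) (inj₂ o) = optimistic ψ o
    optimistic (∀′ φ)   o        = optimistic φ o
    optimistic (K t φ)  _        = true

  lowerBound upperBound : ∀ {n} → Formula n → FOFormula n
  lowerBound φ = replace φ (pessimistic φ)
  upperBound φ = replace φ (optimistic φ)

  module _ (Q : DPWS) where
    mutual
      -- Both bounds are proved together since `¬′` exchanges them. At `K t φ` the bounds are
      -- `const false` and `const true`, so the induction stops there and never inspects `Q`.
      lowerBound⇒Sat : ∀ {n} (φ : Formula n) I (a : Vec D n) →
                       FOSat (lowerBound φ) I a → Sat φ Q I a
      lowerBound⇒Sat (atom P ts) I a s         = s
      lowerBound⇒Sat (t ≈′ u)    I a s         = s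
      lowerBound⇒Sat (¬′ φ)      I a ¬s x      = ¬s (Sat⇒upperBound φ I a x)
      lowerBound⇒Sat (φ ∧′ ψ)    I a (s₁ , s₂) =
        lowerBound⇒Sat φ I a s₁ , lowerBound⇒Sat ψ I a s₂
      lowerBound⇒Sat (∀′ φ)      I a s d       = lowerBound⇒Sat φ I (d ∷ a) (s d)
      lowerBound⇒Sat (K t φ)     I a ()

      Sat⇒upperBound : ∀ {n} (φ : Formula n) I (a : Vec D n) →
                       Sat φ Q I a → FOSat (upperBound φ) I a
      Sat⇒upperBound (atom P ts) I a x         = x
      Sat⇒upperBound (t ≈′ u)    I a x         = x
      Sat⇒upperBound (¬′ φ)      I a ¬x s      = ¬x (lowerBound⇒Sat φ I a s)
      Sat⇒upperBound (φ ∧′ ψ)    I a (x₁ , x₂) =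
        Sat⇒upperBound φ I a x₁ , Sat⇒upperBound ψ I a x₂
      Sat⇒upperBound (∀′ φ)      I a x d       = Sat⇒upperBound φ I (d ∷ a) (x d)
      Sat⇒upperBound (K t φ)     I a x         = _

  -- On inconsistent pairs a formula may be both 𝐭 and 𝐟, so "not 𝐟" does not
  -- follow from "𝐭" and needs its own induction.
  module _ (B : Pair) where
    mutual
      𝐟⇒¬lowerBound : ∀ {n} (φ : Formula n) I (a : Vec D n) →
                      Value φ B I a 𝐟 → ¬ FOSat (lowerBound φ) I a
      𝐟⇒¬lowerBound (atom P ts) I a v           s         = v s
      𝐟⇒¬lowerBound (t ≈′ u)    I a v           s         = v s
      𝐟⇒¬lowerBound (¬′ φ)      I a v           ¬s        = ¬s (𝐭⇒upperBound φ I a v)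
      𝐟⇒¬lowerBound (φ ∧′ ψ)    I a (true  , v) (s₁ , s₂) = 𝐟⇒¬lowerBound φ I a v s₁
      𝐟⇒¬lowerBound (φ ∧′ ψ)    I a (false , v) (s₁ , s₂) = 𝐟⇒¬lowerBound ψ I a v s₂
      𝐟⇒¬lowerBound (∀′ φ)      I a (d , v)     s         = 𝐟⇒¬lowerBound φ I (d ∷ a) v (s d)
      𝐟⇒¬lowerBound (K t φ)     I a v           ()

      𝐭⇒upperBound : ∀ {n} (φ : Formula n) I (a : Vec D n) →
                     Value φ B I a 𝐭 → FOSat (upperBound φ) I a
      𝐭⇒upperBound (atom P ts) I a v   = v
      𝐭⇒upperBound (t ≈′ u)    I a v   = v
      𝐭⇒upperBound (¬′ φ)      I a v s = 𝐟⇒¬lowerBound φ I a v s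
      𝐭⇒upperBound (φ ∧′ ψ)    I a v   =
        𝐭⇒upperBound φ I a (v true) , 𝐭⇒upperBound ψ I a (v false)
      𝐭⇒upperBound (∀′ φ)      I a v d = 𝐭⇒upperBound φ I (d ∷ a) (v d)
      𝐭⇒upperBound (K t φ)     I a v   = _

  module _ (dne : DoubleNegationElimination 0ℓ) (B : Pair) where
    mutual
      -- The companion for negation must produce the value 𝐟, which is stronger than the absence of
      -- 𝐭: for `∧′` and `∀′` it demands a false conjunct or instance. Classical logic supplies that
      -- witness.
      lowerBound⇒𝐭 : ∀ {n} (φ : Formula n) I (a : Vec D n) →
                     FOSat (lowerBound φ) I a → Value φ B I a 𝐭
      lowerBound⇒𝐭 (atom P ts) I a s               = s
      lowerBound⇒𝐭 (t ≈′ u)    I a s               = s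
      lowerBound⇒𝐭 (¬′ φ)      I a ¬s              = ¬upperBound⇒𝐟 φ I a ¬s
      lowerBound⇒𝐭 (φ ∧′ ψ)    I a (s₁ , s₂) true  = lowerBound⇒𝐭 φ I a s₁
      lowerBound⇒𝐭 (φ ∧′ ψ)    I a (s₁ , s₂) false = lowerBound⇒𝐭 ψ I a s₂
      lowerBound⇒𝐭 (∀′ φ)      I a s d             = lowerBound⇒𝐭 φ I (d ∷ a) (s d)
      lowerBound⇒𝐭 (K t φ)     I a ()

      ¬upperBound⇒𝐟 : ∀ {n} (φ : Formula n) I (a : Vec D n) →
                      ¬ FOSat (upperBound φ) I a → Value φ B I a 𝐟
      ¬upperBound⇒𝐟 (atom P ts) I a ¬s = ¬s
      ¬upperBound⇒𝐟 (t ≈′ u)    I a ¬s = ¬s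
      -- Here `¬s` is a double negation of `FOSat (lowerBound φ) I a`.
      ¬upperBound⇒𝐟 (¬′ φ)      I a ¬s = lowerBound⇒𝐭 φ I a (dne ¬s)
      -- If there were no false conjunct, the induction hypotheses would make both upper bounds
      -- hold, against `¬s`. The booleans index the conjuncts in `glb`.
      ¬upperBound⇒𝐟 (φ ∧′ ψ)    I a ¬s = dne λ ¬v → ¬s
        ( dne (λ ¬s₁ → ¬v (true  , ¬upperBound⇒𝐟 φ I a ¬s₁))
        , dne (λ ¬s₂ → ¬v (false , ¬upperBound⇒𝐟 ψ I a ¬s₂)) )
      ¬upperBound⇒𝐟 (∀′ φ)      I a ¬s = dne λ ¬v → ¬s λ d →
        dne λ ¬sd → ¬v (d , ¬upperBound⇒𝐟 φ I (d ∷ a) ¬sd)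
      ¬upperBound⇒𝐟 (K t φ)     I a ¬s with () ← ¬s _

  universallyConsistent-resp-≈K : ∀ {Q Q′} → Q ≈K Q′ →
    UniversallyConsistentDPWS Q → UniversallyConsistentDPWS Q′
  universallyConsistent-resp-≈K Q≈Q′ uc A with I , I∈Q ← uc A =
    I , proj₁ (Q≈Q′ A) I∈Q

  module _ (𝒯 : DistributedTheory) (permaconsistent : Permaconsistent 𝒯) where

    lowerBound-model : ∀ A → ∃[ I ] (∀ φ → 𝒯 A φ → FOSat (lowerBound φ) I [])
    -- `pessimistic` at `n = 0` is itself an admissible replacement for all sentences of `𝒯 A` at
    -- once.
    lowerBound-model A with I , sat ← permaconsistent A pessimistic =
      I , λ φ φ∈𝒯 → sat (lowerBound φ) (φ , φ∈𝒯 , refl)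

    Dop-universallyConsistent : ∀ Q → UniversallyConsistentDPWS (Dop 𝒯 Q)
    Dop-universallyConsistent Q A with I , sat ← lowerBound-model A =
      I , λ φ φ∈𝒯 → lowerBound⇒Sat Q φ I [] (sat φ φ∈𝒯)

    Dᶜ-universallyConsistent : ∀ B → UniversallyConsistentDPWS (Dᶜ 𝒯 B)
    Dᶜ-universallyConsistent B A with I , sat ← lowerBound-model A =
      I , λ ((φ , φ∈𝒯) , v) → 𝐟⇒¬lowerBound B φ I [] v (sat φ φ∈𝒯)

    Dˡ-universallyConsistent : DoubleNegationElimination 0ℓ →
      ∀ B → UniversallyConsistentDPWS (Dˡ 𝒯 B)
    Dˡ-universallyConsistent dne B A with I , sat ← lowerBound-model A =
      I , λ (φ , φ∈𝒯) → lowerBound⇒𝐭 dne B φ I [] (sat φ φ∈𝒯)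

    -- As a value of the stable operator at `c`, the component `l` is a fixpoint of `Dᶜ (_ , c)`.
    -- The pair `(l , c)` is `B` with its components swapped, hence inconsistent unless `B` is
    -- exact; the bound for `Dᶜ` therefore has to cover arbitrary pairs.
    PSt-universallyConsistent : ∀ B → IsPSt 𝒯 B → UniversallyConsistentDBP B
    PSt-universallyConsistent B (_ , l-fixpoint , _) =
      universallyConsistent-resp-≈K l-fixpoint
        (Dᶜ-universallyConsistent (DBP.l B , DBP.c B))

    permaconsistent⇒universallyConsistent : DoubleNegationElimination 0ℓ →
      ∀ σ → UniversallyConsistentUnder σ 𝒯
    permaconsistent⇒universallyConsistent _ Sup Q model =
      universallyConsistent-resp-≈K (lower model) (Dop-universallyConsistent Q)
    -- Here `l` is a fixpoint component of `Dˡ`, whose members must give the theory the value 𝐭;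
    -- this is where `dne` enters.
    permaconsistent⇒universallyConsistent dne KK B ((_ , l-fixpoint) , _) =
      universallyConsistent-resp-≈K l-fixpoint (Dˡ-universallyConsistent dne (DBP.pair B))
    permaconsistent⇒universallyConsistent _ PSt B model = PSt-universallyConsistent B model
    permaconsistent⇒universallyConsistent _ St Q model =
      PSt-universallyConsistent (exact Q) model
    permaconsistent⇒universallyConsistent _ WF B (model , _) =
      PSt-universallyConsistent B model

mainTheorem4 : ExcludedMiddle 0ℓ →
    (S : Setting) (σ : Semantics) (𝒯 : dAEL.DistributedTheory S) →
    dAEL.Permaconsistent S 𝒯 → dAEL.UniversallyConsistentUnder S σ 𝒯
mainTheorem4 em S σ 𝒯 permaconsistent =
  permaconsistent⇒universallyConsistent S 𝒯 permaconsistent (em⇒dne em) σ
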